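{- $\mathrm{Space}(\mathrm{Ordering}_n)=\Omega(n)$, where $\mathrm{Space}$ denotes $\mathrm{Res}(\oplus)$ space.
   Context: $\mathrm{Ordering}_n$ is the CNF in the variables $(x_{ij})_{i\neq j\in[n]}$ consisting of: $\neg x_{ij}\lor\neg x_{ji}$ and $x_{ij}\lor x_{ji}$ for $i\neq j$; $\neg x_{ij}\lor\neg x_{jk}\lor x_{ik}$ for distinct $i,j,k$; $\bigvee_{j\in[n]\setminus\{i\}} x_{ji}$ for each $i\in[n]$. It is viewed as a linear CNF by writing $x$ as $(x=1)$, $\neg x$ as $(x=0)$. $\mathrm{Res}(\oplus)$: linear clauses are disjunctions of equations $f=\alpha$ ($f$ a linear form over $\mathbb{F}_2$, $\alpha\in\{0,1\}$); rules: from $A\lor(f=0)$ and $B\lor(f=1)$ derive $A\lor B$, and from $C$ derive any linear clause semantically implied by $C$. A refutation is a sequence of configurations (sets of linear clauses) $S_1=\emptyset,\dots,S_m$ with $S_m$ containing the empty clause, each obtained from the previous by adding a formula clause, erasing a clause, or adding a clause derived by the rules from current clauses; space is $\max_i|S_i|$, and $\mathrm{Space}$ of a formula is the minimum over its refutations. -}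

module Defs where

open import Data.Nat using (ℕ; _⊔_)
open import Data.Bool using (Bool; true; false; _∧_; _xor_; if_then_else_)
open import Data.Fin using (Fin; _≟_)
open import Data.List using (List; []; _∷_; _++_; foldr; concatMap; map; filter; length; allFin)
open import Data.List.Membership.Propositional using (_∈_)
open import Data.List.Relation.Unary.Any using (Any)
open import Data.Product using (Σ; ∃; _×_; _,_; proj₁; proj₂)
open import Data.Sum using (_⊎_)
open import Relation.Nullary using (¬_; yes; no; ¬?)
open import Relation.Binary.PropositionalEquality using (_≡_; _≢_)

-- Variables of Ordering_n are x_ij for i ≠ j ∈ Fin n.
-- A linear form over F₂ is given by its coefficient vector, written as a
-- function Fin n → Fin n → Bool; diagonal entries (i = j) are never read
-- (they do not correspond to variables).  An assignment likewise.

LinForm : ℕ → Set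
LinForm n = Fin n → Fin n → Bool

Assignment : ℕ → Set
Assignment n = Fin n → Fin n → Bool

bigXor : List Bool → Bool
bigXor = foldr _xor_ false

evalForm : ∀ {n} → LinForm n → Assignment n → Bool
evalForm {n} f α =
  bigXor (concatMap (λ i → map (λ j → term i j) (allFin n)) (allFin n))
  where
  term : Fin n → Fin n → Bool
  term i j with i ≟ j
  ... | yes _ = false
  ... | no  _ = f i j ∧ α i j

_≈F_ : ∀ {n} → LinForm n → LinForm n → Set
_≈F_ {n} f g = (i j : Fin n) → i ≢ j → f i j ≡ g i j

Equation : ℕ → Set
Equation n = LinForm n × Bool

_≈E_ : ∀ {n} → Equation n → Equation n → Set
(f , a) ≈E (g , b) = (f ≈F g) × (a ≡ b)

-- a linear clause: disjunction of linear equations (a finite set,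
-- represented by a list and compared as a set up to equality of equations)
LinClause : ℕ → Set
LinClause n = List (Equation n)

_⊆C_ : ∀ {n} → LinClause n → LinClause n → Set
C ⊆C D = ∀ {e} → e ∈ C → Any (λ e' → e ≈E e') D

_≈C_ : ∀ {n} → LinClause n → LinClause n → Set
C ≈C D = (C ⊆C D) × (D ⊆C C)

SatEq : ∀ {n} → Assignment n → Equation n → Set
SatEq α (f , b) = evalForm f α ≡ b

SatC : ∀ {n} → Assignment n → LinClause n → Set
SatC α C = Any (SatEq α) C

_⊨_ : ∀ {n} → LinClause n → LinClause n → Set
_⊨_ {n} C D = (α : Assignment n) → SatC α C → SatC α D

var : ∀ {n} → Fin n → Fin n → LinForm n
var i j k l with k ≟ i | l ≟ j
... | yes _ | yes _ = true
... | _     | _     = false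

pos neg : ∀ {n} → Fin n → Fin n → Equation n
pos i j = (var i j , true)
neg i j = (var i j , false)

data OrderingClause (n : ℕ) : LinClause n → Set where
  antisym  : (i j : Fin n) → i ≢ j →
             OrderingClause n (neg i j ∷ neg j i ∷ [])
  total    : (i j : Fin n) → i ≢ j →
             OrderingClause n (pos i j ∷ pos j i ∷ [])
  trans    : (i j k : Fin n) → i ≢ j → j ≢ k → i ≢ k →
             OrderingClause n (neg i j ∷ neg j k ∷ pos i k ∷ [])
  nonmin   : (i : Fin n) →
             OrderingClause n (map (λ j → pos j i) (filter (λ j → ¬? (j ≟ i)) (allFin n)))

Config : ℕ → Set
Config n = List (LinClause n)

data Step (n : ℕ) (S : Config n) : Config n → Set where
  axiom   : (C D : LinClause n) → OrderingClause n C → D ≈C C → Step n S (D ∷ S)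
  erase   : (xs ys : Config n) (C : LinClause n) → S ≡ xs ++ (C ∷ ys) →
            Step n S (xs ++ ys)
  resolve : (C₁ C₂ A B D : LinClause n) (f g : LinForm n) →
            C₁ ∈ S → C₂ ∈ S → f ≈F g →
            C₁ ≈C ((f , false) ∷ A) → C₂ ≈C ((g , true) ∷ B) →
            D ≈C (A ++ B) → Step n S (D ∷ S)
  weaken  : (C D : LinClause n) → C ∈ S → C ⊨ D → Step n S (D ∷ S)

data Derivation (n : ℕ) : Config n → Set where
  done : ∀ {S} → [] ∈ S → Derivation n S
  step : ∀ {S S'} → Step n S S' → Derivation n S' → Derivation n S

space : ∀ {n S} → Derivation n S → ℕ
space {S = S} (done _)   = length S
space {S = S} (step _ d) = length S ⊔ space d

Refutation : ℕ → Set
Refutation n = Derivation n []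

-- Track, for the current configuration, a strict linear order α and for each clause one
-- equation that is true at α and implies the clause.  A clause implied by two equations
-- e₁, e₂ together is already implied by e₁, e₂ or e₁ + e₂, so one equation per clause is
-- enough.  An order satisfies every axiom except possibly a non-minimality axiom.  For
-- that one, the indicator of k equations is a polynomial of degree ≤ k over F₂ on the
-- orders of n elements, and when k ≤ n − 2 such a polynomial cannot be nonzero only at
-- orders in which a given element is minimal, so α can be replaced.  Hence a
-- configuration of at most n − 2 clauses never contains the empty clause.

module Submission where

open import Defs
open import Data.Nat using (ℕ; zero; suc; _+_; _≤_; _*_; z≤n; s≤s)
import Data.Nat.Properties as ℕₚ
open import Data.Bool using (Bool; true; false; not; _∧_; _xor_)
open import Data.Bool.Properties using (∧-assoc; ∧-zeroʳ; ∧-distribˡ-xor; ∧-distribʳ-xor; xor-assoc; xor-identityʳ; xor-∧-commutativeRing)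
import Data.Bool.Properties as Boolₚ
open import Data.Fin using (Fin; zero; suc; fromℕ; _≟_)
open import Data.Fin.Properties using (suc-injective)
open import Data.Fin.Permutation.Components using (transpose; transpose-inverse)
open import Data.List using (List; []; _∷_; _++_; concatMap; map; length; tabulate; allFin)
open import Data.List.Membership.Propositional using (find; lose)
open import Data.List.Membership.Propositional.Properties using (∈-map⁺; ∈-filter⁺; ∈-allFin)
open import Data.List.Relation.Unary.All as All using (All; []; _∷_)
import Data.List.Relation.Unary.All.Properties as Allₚ
open import Data.List.Relation.Unary.Any as Any using (here; there)
import Data.List.Relation.Unary.Any.Properties as Anyₚ
open import Data.Product using (∃; ∃₂; _×_; _,_; proj₁; proj₂)
open import Data.Sum using (_⊎_; inj₁; inj₂)
open import Function using (_∘_)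
open import Relation.Nullary using (¬_; Dec; does; yes; no; ¬?; contradiction)
open import Relation.Nullary.Decidable using (decidable-stable; dec-true; dec-false)
open import Relation.Binary.PropositionalEquality
  using (_≡_; _≢_; refl; sym; cong; cong₂; subst; module ≡-Reasoning)
  renaming (trans to ≡-trans)
open import Algebra.Bundles using (CommutativeRing)
open import Algebra.Properties.CommutativeSemigroup
  (CommutativeRing.+-commutativeSemigroup xor-∧-commutativeRing)
  using () renaming (interchange to xor-interchange; x∙yz≈y∙xz to xor-swap)
open import Algebra.Properties.CommutativeSemigroup
  (CommutativeRing.*-commutativeSemigroup xor-∧-commutativeRing)
  using () renaming (x∙yz≈y∙xz to ∧-swap)
open import Algebra.Properties.Semiring.Sum (CommutativeRing.semiring xor-∧-commutativeRing)
  using (sum; sum-cong-≗; ∑-distrib-+; sum-replicate-zero; *-distribˡ-sum; *-distribʳ-sum)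

-- Sums over F₂ and evaluation of linear forms

sum-δ : ∀ {n} (a : Fin n) (f : Fin n → Bool) → sum (λ b → does (b ≟ a) ∧ f b) ≡ f a
sum-δ {suc n} zero    f = ≡-trans (cong (f zero xor_) (sum-replicate-zero n)) (xor-identityʳ (f zero))
sum-δ {suc n} (suc a) f = sum-δ a (f ∘ suc)

bigXor-++ : ∀ xs ys → bigXor (xs ++ ys) ≡ bigXor xs xor bigXor ys
bigXor-++ []       ys = refl
bigXor-++ (x ∷ xs) ys = ≡-trans (cong (x xor_) (bigXor-++ xs ys)) (sym (xor-assoc x _ _))

bigXor-map-tabulate : ∀ {n} {A : Set} (h : A → Bool) (g : Fin n → A) →
  bigXor (map h (tabulate g)) ≡ sum (h ∘ g)
bigXor-map-tabulate {zero}  h g = refl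
bigXor-map-tabulate {suc n} h g = cong (h (g zero) xor_) (bigXor-map-tabulate h (g ∘ suc))

bigXor-concatMap-tabulate : ∀ {n} {A : Set} (h : A → List Bool) (g : Fin n → A) →
  bigXor (concatMap h (tabulate g)) ≡ sum (bigXor ∘ h ∘ g)
bigXor-concatMap-tabulate {zero}  h g = refl
bigXor-concatMap-tabulate {suc n} h g = ≡-trans (bigXor-++ (h (g zero)) _)
  (cong (bigXor (h (g zero)) xor_) (bigXor-concatMap-tabulate h (g ∘ suc)))

-- Recovers the summand that is local to the definition of evalForm.
evalForm-term : ∀ {n} → ∃ λ (t : LinForm n → Assignment n → Fin n → Fin n → Bool) →
  ∀ f α → evalForm f α ≡ bigXor (concatMap (λ i → map (t f α i) (allFin n)) (allFin n))
evalForm-term = _ , λ f α → refl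

-- The case split of `evalForm` on the diagonal becomes a Boolean factor, so that distributivity and
-- the sum lemmas apply to it.
offDiagonal : ∀ {n} → (Fin n → Fin n → Bool) → Fin n → Fin n → Bool
offDiagonal t i j = not (does (i ≟ j)) ∧ t i j

evalForm-term-≡ : ∀ {n} (f : LinForm n) α i j →
  proj₁ evalForm-term f α i j ≡ offDiagonal (λ i j → f i j ∧ α i j) i j
evalForm-term-≡ f α i j with i ≟ j
... | yes _ = refl
... | no  _ = refl

evalForm-sum : ∀ {n} (f : LinForm n) α →
  evalForm f α ≡ sum λ i → sum λ j → offDiagonal (λ i j → f i j ∧ α i j) i j
evalForm-sum f α = ≡-trans (proj₂ evalForm-term f α) (≡-trans (bigXor-concatMap-tabulate (λ i → map (t i) (allFin _)) (λ i → i))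
  (sum-cong-≗ λ i → ≡-trans (bigXor-map-tabulate (t i) (λ j → j)) (sum-cong-≗ (evalForm-term-≡ f α i))))
  where t = proj₁ evalForm-term f α

evalForm-congˡ : ∀ {n} {f g : LinForm n} → f ≈F g → ∀ α → evalForm f α ≡ evalForm g α
evalForm-congˡ {f = f} {g} f≈g α = ≡-trans (evalForm-sum f α)
  (≡-trans (sum-cong-≗ λ i → sum-cong-≗ (entry i)) (sym (evalForm-sum g α)))
  where
  entry : ∀ i j → offDiagonal (λ i j → f i j ∧ α i j) i j ≡ offDiagonal (λ i j → g i j ∧ α i j) i j
  entry i j with i ≟ j
  ... | yes _   = refl
  ... | no  i≢j = cong (_∧ α i j) (f≈g i j i≢j)

evalForm-congʳ : ∀ {n} (f : LinForm n) {α β} → (∀ i j → α i j ≡ β i j) → evalForm f α ≡ evalForm f β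
evalForm-congʳ f {α} {β} α≡β = ≡-trans (evalForm-sum f α) (≡-trans
  (sum-cong-≗ λ i → sum-cong-≗ λ j → cong (λ x → not (does (i ≟ j)) ∧ (f i j ∧ x)) (α≡β i j))
  (sym (evalForm-sum f β)))

sum²-xor : ∀ {n} (s t : Fin n → Fin n → Bool) →
  sum (λ i → sum λ j → s i j xor t i j) ≡ sum (λ i → sum (s i)) xor sum (λ i → sum (t i))
sum²-xor s t = ≡-trans (sum-cong-≗ λ i → ∑-distrib-+ (s i) (t i))
  (∑-distrib-+ (λ i → sum (s i)) (λ i → sum (t i)))

evalForm-xorˡ : ∀ {n} (f g : LinForm n) α →
  evalForm (λ i j → f i j xor g i j) α ≡ evalForm f α xor evalForm g α
evalForm-xorˡ f g α = begin
  evalForm (λ i j → f i j xor g i j) α ≡⟨ evalForm-sum _ α ⟩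
  _ ≡⟨ (sum-cong-≗ λ i → sum-cong-≗ λ j → ≡-trans
         (cong (not (does (i ≟ j)) ∧_) (∧-distribʳ-xor (α i j) (f i j) (g i j)))
         (∧-distribˡ-xor (not (does (i ≟ j))) (f i j ∧ α i j) (g i j ∧ α i j))) ⟩
  _ ≡⟨ sum²-xor (offDiagonal λ i j → f i j ∧ α i j) (offDiagonal λ i j → g i j ∧ α i j) ⟩
  _ ≡⟨ cong₂ _xor_ (evalForm-sum f α) (evalForm-sum g α) ⟨
  evalForm f α xor evalForm g α ∎
  where open ≡-Reasoning

evalForm-xorʳ : ∀ {n} (f : LinForm n) α β →
  evalForm f (λ i j → α i j xor β i j) ≡ evalForm f α xor evalForm f β
evalForm-xorʳ f α β = begin
  evalForm f (λ i j → α i j xor β i j) ≡⟨ evalForm-sum f _ ⟩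
  _ ≡⟨ (sum-cong-≗ λ i → sum-cong-≗ λ j → ≡-trans
         (cong (not (does (i ≟ j)) ∧_) (∧-distribˡ-xor (f i j) (α i j) (β i j)))
         (∧-distribˡ-xor (not (does (i ≟ j))) (f i j ∧ α i j) (f i j ∧ β i j))) ⟩
  _ ≡⟨ sum²-xor (offDiagonal λ i j → f i j ∧ α i j) (offDiagonal λ i j → f i j ∧ β i j) ⟩
  _ ≡⟨ cong₂ _xor_ (evalForm-sum f α) (evalForm-sum f β) ⟨
  evalForm f α xor evalForm f β ∎
  where open ≡-Reasoning

var-≟ : ∀ {n} (i j k l : Fin n) → var i j k l ≡ does (k ≟ i) ∧ does (l ≟ j)
var-≟ i j k l with k ≟ i | l ≟ j
... | yes _ | yes _ = refl
... | yes _ | no  _ = refl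
... | no  _ | _     = refl

evalForm-var : ∀ {n} {i j : Fin n} → i ≢ j → ∀ α → evalForm (var i j) α ≡ α i j
evalForm-var {i = i} {j} i≢j α = begin
  evalForm (var i j) α ≡⟨ evalForm-sum _ α ⟩
  _ ≡⟨ sum-cong-≗ (λ k → sum-cong-≗ λ l → entry k l) ⟩
  _ ≡⟨ sum-cong-≗ (λ k → *-distribˡ-sum (does (k ≟ i)) (λ l → does (l ≟ j) ∧ a k l)) ⟨
  _ ≡⟨ sum-δ i (λ k → sum λ l → does (l ≟ j) ∧ a k l) ⟩
  _ ≡⟨ sum-δ j (a i) ⟩
  not (does (i ≟ j)) ∧ α i j ≡⟨ cong (λ b → not b ∧ α i j) (dec-false (i ≟ j) i≢j) ⟩
  α i j ∎
  where
  open ≡-Reasoning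
  a = offDiagonal α
  entry : ∀ k l → offDiagonal (λ k l → var i j k l ∧ α k l) k l ≡ does (k ≟ i) ∧ (does (l ≟ j) ∧ a k l)
  entry k l rewrite var-≟ i j k l with does (k ≟ i) | does (l ≟ j)
  ... | true  | true  = refl
  ... | true  | false = ∧-zeroʳ _
  ... | false | _     = ∧-zeroʳ _

-- Strict linear orders, given by their relation

record IsOrder {n} (r : Assignment n) : Set where
  field
    irrefl  : ∀ a → r a a ≡ false
    compare : ∀ {a b} → a ≢ b → r a b ≡ not (r b a)
    transit : ∀ {a b c} → r a b ≡ true → r b c ≡ true → r a c ≡ true

open IsOrder

IsOrder-∘ : ∀ {m n} {r : Assignment n} (h : Fin m → Fin n) → (∀ {a b} → h a ≡ h b → a ≡ b) →
  IsOrder r → IsOrder (λ a b → r (h a) (h b))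
IsOrder-∘ h h-inj o = record
  { irrefl  = λ a → irrefl o (h a)
  ; compare = λ a≢b → compare o (a≢b ∘ h-inj)
  ; transit = transit o
  }

restrict : ∀ {n} → Assignment (suc n) → Assignment n
restrict r a b = r (suc a) (suc b)

IsOrder-restrict : ∀ {n} {r : Assignment (suc n)} → IsOrder r → IsOrder (restrict r)
IsOrder-restrict = IsOrder-∘ suc suc-injective

-- The new element zero is placed directly above the set c.
insert : ∀ {n} → Assignment n → (Fin n → Bool) → Assignment (suc n)
insert r c zero    zero    = false
insert r c zero    (suc b) = not (c b)
insert r c (suc a) zero    = c a
insert r c (suc a) (suc b) = r a b

-- The hypothesis makes `c` an initial segment of `r`. This is what transitivity through the new
-- element requires.
IsOrder-insert : ∀ {n} {r : Assignment n} {c} → IsOrder r →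
  (∀ {a b} → r a b ≡ true → c b ≡ true → c a ≡ true) → IsOrder (insert r c)
IsOrder-insert {r = r} {c} o down = record { irrefl = ir ; compare = cm ; transit = λ {a} {b} {d} → tr {a} {b} {d} }
  where
  ir : ∀ a → insert r c a a ≡ false
  ir zero    = refl
  ir (suc a) = irrefl o a
  cm : ∀ {a b} → a ≢ b → insert r c a b ≡ not (insert r c b a)
  cm {zero}  {zero}  a≢b = contradiction refl a≢b
  cm {zero}  {suc b} a≢b = refl
  cm {suc a} {zero}  a≢b = sym (Boolₚ.not-involutive (c a))
  cm {suc a} {suc b} a≢b = compare o (a≢b ∘ cong suc)
  tr : ∀ {a b d} → insert r c a b ≡ true → insert r c b d ≡ true → insert r c a d ≡ true
  tr {suc a} {suc b} {suc d} p q = transit o p q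
  tr {suc a} {suc b} {zero}  p q = down p q
  tr {zero}  {suc b} {zero}  p q with c b
  tr {zero}  {suc b} {zero}  () q | true
  tr {zero}  {suc b} {zero}  p () | false
  -- Here `a` lies in `c` and `d` does not. If `d` preceded `a`, closure would put `d` into `c`, so
  -- `a` precedes `d`.
  tr {suc a} {zero}  {suc d} p q with a ≟ d
  ... | yes refl rewrite p = contradiction q λ ()
  ... | no  a≢d with r d a in da
  ...   | false = ≡-trans (compare o a≢d) (cong not da)
  ...   | true  rewrite down da p = contradiction q λ ()
  tr {zero}  {suc b} {suc d} p q with c d in cd
  ... | false = refl
  ... | true  rewrite down q cd = contradiction p λ ()

IsOrder-insert-bottom : ∀ {n} {r : Assignment n} → IsOrder r → IsOrder (insert r λ _ → false)
IsOrder-insert-bottom o = IsOrder-insert o λ _ ()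

order-exists : ∀ n → ∃ λ (r : Assignment n) → IsOrder r
order-exists zero    = (λ ()) , record { irrefl = λ () ; compare = λ { {()} } ; transit = λ { {()} } }
order-exists (suc n) = _ , IsOrder-insert-bottom (proj₂ (order-exists n))

-- Functions of low degree on orders

-- f is a polynomial of degree < k in the variables x_ab on the orders of Fin n.  Since
-- x_ac x_bc = x_ab x_bc + (1 + x_ab) x_ac on orders, no monomial needs two variables
-- x_ac, x_bc into the same new element c.
LowDegree : (n k : ℕ) → (Assignment n → Bool) → Set
LowDegree n       zero    f = ∀ r → IsOrder r → f r ≡ false
LowDegree zero    (suc k) f = ∃ λ b → ∀ r → IsOrder r → f r ≡ b
LowDegree (suc n) (suc k) f = ∃₂ λ p₀ (p : Fin n → Assignment n → Bool) →
  LowDegree n (suc k) p₀ × (∀ a → LowDegree n k (p a)) ×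
  (∀ r → IsOrder r → f r ≡ p₀ (restrict r) xor sum (λ a → r (suc a) zero ∧ p a (restrict r)))

low-cong : ∀ n k {f g} → (∀ r → IsOrder r → g r ≡ f r) → LowDegree n k f → LowDegree n k g
low-cong n       zero    eq l = λ r o → ≡-trans (eq r o) (l r o)
low-cong zero    (suc k) eq (b , l) = b , λ r o → ≡-trans (eq r o) (l r o)
low-cong (suc n) (suc k) eq (p₀ , p , l₀ , l , e) = p₀ , p , l₀ , l , λ r o → ≡-trans (eq r o) (e r o)

sum-∧-false : ∀ {n} (f : Fin n → Bool) → sum (λ a → f a ∧ false) ≡ false
sum-∧-false {n} f = ≡-trans (sum-cong-≗ λ a → ∧-zeroʳ (f a)) (sum-replicate-zero n)

low-false : ∀ n k → LowDegree n k (λ _ → false)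
low-false n       zero    = λ _ _ → refl
low-false zero    (suc k) = false , λ _ _ → refl
low-false (suc n) (suc k) = _ , _ , low-false n (suc k) , (λ _ → low-false n k) ,
  λ r o → sym (sum-∧-false λ a → r (suc a) zero)

low-const : ∀ n k b → LowDegree n (suc k) (λ _ → b)
low-const zero    k b = b , λ _ _ → refl
low-const (suc n) k b = _ , _ , low-const n k b , (λ _ → low-false n k) ,
  λ r o → sym (≡-trans (cong (b xor_) (sum-∧-false λ a → r (suc a) zero)) (xor-identityʳ b))

low-suc : ∀ n k {f} → LowDegree n k f → LowDegree n (suc k) f
low-suc n       zero    l = low-cong n 1 l (low-false n 1)
low-suc zero    (suc k) l = l
low-suc (suc n) (suc k) (p₀ , p , l₀ , l , e) =
  p₀ , p , low-suc n (suc k) l₀ , (λ a → low-suc n k (l a)) , e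

low-const-∧ : ∀ n k b {f} → LowDegree n k f → LowDegree n k (λ r → b ∧ f r)
low-const-∧ n k false l = low-false n k
low-const-∧ n k true  l = l

low-xor : ∀ n k {f g} → LowDegree n k f → LowDegree n k g → LowDegree n k (λ r → f r xor g r)
low-xor n       zero    lf lg = λ r o → cong₂ _xor_ (lf r o) (lg r o)
low-xor zero    (suc k) (b , lf) (c , lg) = b xor c , λ r o → cong₂ _xor_ (lf r o) (lg r o)
low-xor (suc n) (suc k) {f} {g} (p₀ , p , lp₀ , lp , ep) (q₀ , q , lq₀ , lq , eq) =
  _ , _ , low-xor n (suc k) lp₀ lq₀ , (λ a → low-xor n k (lp a) (lq a)) , expand
  where
  open ≡-Reasoning
  expand : ∀ r → IsOrder r → f r xor g r ≡ (p₀ (restrict r) xor q₀ (restrict r)) xor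
    sum (λ a → r (suc a) zero ∧ (p a (restrict r) xor q a (restrict r)))
  expand r o = begin
    f r xor g r ≡⟨ cong₂ _xor_ (ep r o) (eq r o) ⟩
    _ ≡⟨ xor-interchange (p₀ s) (sum xp) (q₀ s) (sum xq) ⟩
    _ ≡⟨ cong ((p₀ s xor q₀ s) xor_) (∑-distrib-+ xp xq) ⟨
    _ ≡⟨ cong ((p₀ s xor q₀ s) xor_) (sum-cong-≗ λ a → ∧-distribˡ-xor (r (suc a) zero) (p a s) (q a s)) ⟨
    _ ∎
    where
    s  = restrict r
    xp = λ a → r (suc a) zero ∧ p a s
    xq = λ a → r (suc a) zero ∧ q a s

low-sum : ∀ n k {m} {f : Fin m → Assignment n → Bool} → (∀ i → LowDegree n k (f i)) →
  LowDegree n k (λ r → sum λ i → f i r)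
low-sum n k {zero}  l = low-false n k
low-sum n k {suc m} l = low-xor n k (l zero) (low-sum n k (l ∘ suc))

-- If `a` precedes `b`, both lie below the new element exactly when `b` does; otherwise exactly when
-- `a` does. So a product of two variables into `zero` splits into terms with one such variable
-- each, at the price of a factor on the old elements.
var-insert-∧ : ∀ {n} {r : Assignment (suc n)} → IsOrder r → ∀ a b p →
  (r (suc a) zero ∧ (p xor (r (suc a) (suc b) ∧ p))) xor (r (suc b) zero ∧ (r (suc a) (suc b) ∧ p))
    ≡ r (suc b) zero ∧ (r (suc a) zero ∧ p)
var-insert-∧ {r = r} o a b p with r (suc a) (suc b) in ab | r (suc a) zero in a0 | r (suc b) zero in b0
var-insert-∧ o a b true  | true  | true  | true  = refl
var-insert-∧ o a b false | true  | true  | true  = refl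
var-insert-∧ o a b p     | true  | false | true  = contradiction (≡-trans (sym a0) (transit o ab b0)) λ ()
var-insert-∧ o a b true  | true  | true  | false = refl
var-insert-∧ o a b false | true  | true  | false = refl
var-insert-∧ o a b p     | true  | false | false = refl
var-insert-∧ o a b true  | false | true  | true  = refl
var-insert-∧ o a b false | false | true  | true  = refl
var-insert-∧ o a b p     | false | false | true  = refl
var-insert-∧ o a b p     | false | false | false = refl
var-insert-∧ {r = r} o a b p | false | true | false with a ≟ b
... | yes refl = contradiction (≡-trans (sym a0) b0) λ ()
... | no  a≢b  = contradiction (≡-trans (sym b0) (transit o ba a0)) λ ()
  where
  ba : r (suc b) (suc a) ≡ true
  ba = ≡-trans (compare o (a≢b ∘ sym ∘ suc-injective)) (cong not ab)

-- Induction on the number of elements: a variable between old elements multiplies every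
-- coefficient, and a variable involving `zero` reduces to `low-var-insert`, which in turn needs
-- this lemma for the coefficients.
low-var : ∀ n k a b {f} → LowDegree n k f → LowDegree n (suc k) (λ r → r a b ∧ f r)

low-var-insert : ∀ n k b {f} → LowDegree (suc n) (suc k) f →
  LowDegree (suc n) (suc (suc k)) (λ r → r (suc b) zero ∧ f r)
low-var-insert n k b {f} (p₀ , p , l₀ , l , e) =
  -- After the rewriting every term has a variable into `zero`, so the constant part is `false`. All
  -- terms with factor `r (suc b) zero` are collected in `v`, and `does (a ≟ b)` places them at
  -- index `b` only.
  (λ _ → false) , (λ a s → u a s xor (does (a ≟ b) ∧ v s)) , low-false n (suc (suc k)) ,
  (λ a → low-xor n (suc k)
    (low-xor n (suc k) (low-suc n k (l a)) (low-var n k a b (l a)))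
    (low-const-∧ n (suc k) (does (a ≟ b)) (low-xor n (suc k) l₀ (low-sum n (suc k) λ c → low-var n k c b (l c))))) ,
  expand
  where
  open ≡-Reasoning
  u : Fin n → Assignment n → Bool
  u a s = p a s xor (s a b ∧ p a s)
  t : Fin n → Assignment n → Bool
  t c s = s c b ∧ p c s
  v : Assignment n → Bool
  v s = p₀ s xor sum (λ c → t c s)
  expand : ∀ r → IsOrder r → r (suc b) zero ∧ f r ≡
    sum (λ a → r (suc a) zero ∧ (u a (restrict r) xor (does (a ≟ b) ∧ v (restrict r))))
  expand r o = begin
    x b ∧ f r
      ≡⟨ cong (x b ∧_) (e r o) ⟩
    x b ∧ (p₀ s xor sum (λ a → x a ∧ p a s))
      ≡⟨ ∧-distribˡ-xor (x b) (p₀ s) (sum λ a → x a ∧ p a s) ⟩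
    (x b ∧ p₀ s) xor (x b ∧ sum (λ a → x a ∧ p a s))
      ≡⟨ cong ((x b ∧ p₀ s) xor_) reduce ⟩
    (x b ∧ p₀ s) xor (sum (λ a → x a ∧ u a s) xor (x b ∧ T))
      ≡⟨ xor-swap (x b ∧ p₀ s) (sum λ a → x a ∧ u a s) (x b ∧ T) ⟩
    sum (λ a → x a ∧ u a s) xor ((x b ∧ p₀ s) xor (x b ∧ T))
      ≡⟨ cong (sum (λ a → x a ∧ u a s) xor_) (∧-distribˡ-xor (x b) (p₀ s) T) ⟨
    sum (λ a → x a ∧ u a s) xor (x b ∧ v s)
      ≡⟨ cong (sum (λ a → x a ∧ u a s) xor_) (sum-δ b (λ a → x a ∧ v s)) ⟨
    sum (λ a → x a ∧ u a s) xor sum (λ a → does (a ≟ b) ∧ (x a ∧ v s))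
      ≡⟨ ∑-distrib-+ (λ a → x a ∧ u a s) (λ a → does (a ≟ b) ∧ (x a ∧ v s)) ⟨
    sum (λ a → (x a ∧ u a s) xor (does (a ≟ b) ∧ (x a ∧ v s)))
      ≡⟨ sum-cong-≗ (λ a → ≡-trans (∧-distribˡ-xor (x a) (u a s) (does (a ≟ b) ∧ v s))
           (cong ((x a ∧ u a s) xor_) (∧-swap (x a) (does (a ≟ b)) (v s)))) ⟨
    sum (λ a → x a ∧ (u a s xor (does (a ≟ b) ∧ v s))) ∎
    where
    s = restrict r
    x = λ a → r (suc a) zero
    T = sum (λ a → t a s)
    reduce : x b ∧ sum (λ a → x a ∧ p a s) ≡ sum (λ a → x a ∧ u a s) xor (x b ∧ T)
    reduce = begin
      x b ∧ sum (λ a → x a ∧ p a s)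
        ≡⟨ *-distribˡ-sum (x b) (λ a → x a ∧ p a s) ⟩
      sum (λ a → x b ∧ (x a ∧ p a s))
        ≡⟨ sum-cong-≗ (λ a → var-insert-∧ o a b (p a s)) ⟨
      sum (λ a → (x a ∧ u a s) xor (x b ∧ t a s))
        ≡⟨ ∑-distrib-+ (λ a → x a ∧ u a s) (λ a → x b ∧ t a s) ⟩
      sum (λ a → x a ∧ u a s) xor sum (λ a → x b ∧ t a s)
        ≡⟨ cong (sum (λ a → x a ∧ u a s) xor_) (*-distribˡ-sum (x b) (λ a → t a s)) ⟨
      sum (λ a → x a ∧ u a s) xor (x b ∧ T) ∎

low-var n       zero    a       b       l =
  low-cong n 1 (λ r o → ≡-trans (cong (r a b ∧_) (l r o)) (∧-zeroʳ (r a b))) (low-false n 1)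
low-var (suc n) (suc k) (suc a) (suc b) {f} (p₀ , p , l₀ , l , e) =
  _ , _ , low-var n (suc k) a b l₀ , (λ c → low-var n k a b (l c)) , expand
  where
  open ≡-Reasoning
  expand : ∀ r → IsOrder r → r (suc a) (suc b) ∧ f r ≡ (r (suc a) (suc b) ∧ p₀ (restrict r)) xor
    sum (λ c → r (suc c) zero ∧ (r (suc a) (suc b) ∧ p c (restrict r)))
  expand r o = begin
    x ∧ f r ≡⟨ cong (x ∧_) (e r o) ⟩
    _ ≡⟨ ∧-distribˡ-xor x (p₀ s) (sum xp) ⟩
    _ ≡⟨ cong ((x ∧ p₀ s) xor_) (*-distribˡ-sum x xp) ⟩
    _ ≡⟨ cong ((x ∧ p₀ s) xor_) (sum-cong-≗ λ c → ∧-swap x (r (suc c) zero) (p c s)) ⟩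
    _ ∎
    where
    s  = restrict r
    x  = r (suc a) (suc b)
    xp = λ c → r (suc c) zero ∧ p c s
low-var (suc n) (suc k) (suc b) zero    l = low-var-insert n k b l
low-var (suc n) (suc k) zero    zero    {f} l =
  low-cong (suc n) (suc (suc k)) (λ r o → cong (_∧ f r) (irrefl o zero)) (low-false (suc n) (suc (suc k)))
low-var (suc n) (suc k) zero    (suc b) {f} l =
  -- On orders `r zero (suc b)` is one plus `r (suc b) zero`, so the product is `f` plus a product
  -- already treated.
  low-cong (suc n) (suc (suc k)) flip
    (low-xor (suc n) (suc (suc k)) (low-suc (suc n) (suc k) l) (low-var-insert n k b l))
  where
  flip : ∀ r → IsOrder r → r zero (suc b) ∧ f r ≡ f r xor (r (suc b) zero ∧ f r)
  flip r o rewrite compare o {zero} {suc b} (λ ()) with r (suc b) zero | f r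
  ... | true  | true  = refl
  ... | true  | false = refl
  ... | false | true  = refl
  ... | false | false = refl

-- Indicators of systems of linear equations

low-evalForm : ∀ {n} m k (f : LinForm n) (h : Fin n → Fin m) {g} → LowDegree m k g →
  LowDegree m (suc k) (λ r → evalForm f (λ i j → r (h i) (h j)) ∧ g r)
low-evalForm m k f h {g} l = low-cong m (suc k) expand
  (low-sum m (suc k) λ i → low-sum m (suc k) λ j →
    low-const-∧ m (suc k) (not (does (i ≟ j))) (low-const-∧ m (suc k) (f i j) (low-var m k (h i) (h j) l)))
  where
  open ≡-Reasoning
  expand : ∀ r → IsOrder r → evalForm f (λ i j → r (h i) (h j)) ∧ g r ≡
    sum λ i → sum λ j → not (does (i ≟ j)) ∧ (f i j ∧ (r (h i) (h j) ∧ g r))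
  expand r _ = begin
    evalForm f α ∧ g r
      ≡⟨ cong (_∧ g r) (evalForm-sum f α) ⟩
    sum (λ i → sum (t i)) ∧ g r
      ≡⟨ *-distribʳ-sum (g r) (λ i → sum (t i)) ⟩
    sum (λ i → sum (t i) ∧ g r)
      ≡⟨ sum-cong-≗ (λ i → ≡-trans (*-distribʳ-sum (g r) (t i)) (sum-cong-≗ λ j → ≡-trans
           (∧-assoc (not (does (i ≟ j))) (f i j ∧ α i j) (g r))
           (cong (not (does (i ≟ j)) ∧_) (∧-assoc (f i j) (α i j) (g r))))) ⟩
    _ ∎
    where
    α = λ i j → r (h i) (h j)
    t = offDiagonal (λ i j → f i j ∧ α i j)

-- The indicator is written as a product of affine forms, `evalForm f α xor not b` being one exactly
-- where the equation holds, so that its degree can be read off.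
satisfies : ∀ {n} → List (Equation n) → Assignment n → Bool
satisfies []            α = true
satisfies ((f , b) ∷ Φ) α = (evalForm f α xor not b) ∧ satisfies Φ α

satisfies⁺ : ∀ {n} {Φ : List (Equation n)} {α} → All (SatEq α) Φ → satisfies Φ α ≡ true
satisfies⁺ []                                 = refl
satisfies⁺ {α = α} (_∷_ {x = f , b} refl sat) = cong₂ _∧_ (Boolₚ.xor-inverseʳ (evalForm f α)) (satisfies⁺ sat)

satisfies⁻ : ∀ {n} (Φ : List (Equation n)) {α} → satisfies Φ α ≡ true → All (SatEq α) Φ
satisfies⁻ []            _ = []
satisfies⁻ ((f , b) ∷ Φ) {α} eq with evalForm f α in ev | b
... | true  | true  = ev ∷ satisfies⁻ Φ eq
... | false | false = ev ∷ satisfies⁻ Φ eq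

-- Each equation contributes one factor of degree at most one. The renaming `h` is carried along so
-- that any chosen element can later be moved to the last position.
low-satisfies : ∀ {n} m (Φ : List (Equation n)) (h : Fin n → Fin m) →
  LowDegree m (suc (length Φ)) (λ r → satisfies Φ (λ i j → r (h i) (h j)))
low-satisfies m []            h = low-const m 0 true
low-satisfies m ((f , b) ∷ Φ) h =
  low-cong m (2 + length Φ) (λ r _ → ∧-distribʳ-xor _ (evalForm f _) (not b))
    (low-xor m (2 + length Φ)
      (low-evalForm m (suc (length Φ)) f h (low-satisfies m Φ h))
      (low-suc m (suc (length Φ)) (low-const-∧ m (suc (length Φ)) (not b) (low-satisfies m Φ h))))

-- Moving to an order in which a given element is not minimal

sum-true : ∀ {n} (f : Fin n → Bool) → sum f ≡ true → ∃ λ a → f a ≡ true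
sum-true {suc n} f eq with f zero in f0
... | true  = zero , f0
... | false with sum-true (f ∘ suc) eq
...   | a , fa = suc a , fa

∧-true : ∀ {a b} → a ∧ b ≡ true → a ≡ true × b ≡ true
∧-true {true} {true} _ = refl , refl

-- Either the value of f is already attained with the new element at the bottom, or some
-- coefficient p a is nonzero; then move inductively to an order where p a is nonzero, and
-- place the new element just below or just above a, which changes the value of f by p a.
raise-last : ∀ n k {f} → LowDegree (suc n) k f → k ≤ n → ∀ r → IsOrder r → f r ≡ true →
  ∃ λ r′ → IsOrder r′ × f r′ ≡ true × ∃ λ a → r′ a (fromℕ n) ≡ true
raise-last n       zero    l _ r o fr = contradiction (≡-trans (sym fr) (l r o)) λ ()
raise-last (suc n) (suc k) {f} (p₀ , p , l₀ , l , e) (s≤s k≤n) r o fr with p₀ (restrict r) in p₀r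
-- With the new element at the bottom all variables into `zero` vanish, so `f r′` equals `p₀`, and
-- `zero` itself lies below the last element.
... | true  = r′ , o′ , fr′ , zero , refl
  where
  r′ = insert (restrict r) (λ _ → false)
  o′ : IsOrder r′
  o′ = IsOrder-insert-bottom (IsOrder-restrict o)
  fr′ : f r′ ≡ true
  fr′ = ≡-trans (e r′ o′) (cong₂ _xor_ p₀r (sum-replicate-zero (suc n)))
... | false with sum-true (λ a → r (suc a) zero ∧ p a (restrict r))
  (≡-trans (sym (≡-trans (e r o) (cong (_xor _) p₀r))) fr)
...   | a , xpa with raise-last n k (l a) k≤n (restrict r) (IsOrder-restrict o) (proj₂ (∧-true xpa))
...     | s , os , pas , c , below = choose
  where
  open ≡-Reasoning
  lower upper : Assignment (suc (suc n))
  lower = insert s (λ b → s b a)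
  -- Since `s` is irreflexive, the xor adds `a` itself to its set of predecessors. Compared with
  -- `lower`, only the variable from `a` into the new element changes.
  upper = insert s (λ b → s b a xor does (b ≟ a))
  o-lower : IsOrder lower
  o-lower = IsOrder-insert os (transit os)
  o-upper : IsOrder upper
  o-upper = IsOrder-insert os down
    where
    down : ∀ {b d} → s b d ≡ true → s d a xor does (d ≟ a) ≡ true → s b a xor does (b ≟ a) ≡ true
    down {b} {d} bd da with b ≟ a
    ... | yes refl = cong (_xor true) (irrefl os b)
    ... | no  b≢a  with d ≟ a
    ...   | yes refl = ≡-trans (xor-identityʳ _) bd
    ...   | no  d≢a  = ≡-trans (xor-identityʳ _) (transit os bd (≡-trans (sym (xor-identityʳ _)) da))
  f-upper : f upper ≡ not (f lower)
  f-upper = begin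
    f upper
      ≡⟨ e upper o-upper ⟩
    p₀ s xor sum (λ b → (s b a xor does (b ≟ a)) ∧ p b s)
      ≡⟨ cong (p₀ s xor_) (sum-cong-≗ λ b → ∧-distribʳ-xor (p b s) (s b a) (does (b ≟ a))) ⟩
    p₀ s xor sum (λ b → (s b a ∧ p b s) xor (does (b ≟ a) ∧ p b s))
      ≡⟨ cong (p₀ s xor_) (∑-distrib-+ (λ b → s b a ∧ p b s) (λ b → does (b ≟ a) ∧ p b s)) ⟩
    p₀ s xor (sum (λ b → s b a ∧ p b s) xor sum (λ b → does (b ≟ a) ∧ p b s))
      ≡⟨ xor-assoc (p₀ s) _ _ ⟨
    (p₀ s xor sum (λ b → s b a ∧ p b s)) xor sum (λ b → does (b ≟ a) ∧ p b s)
      ≡⟨ cong₂ _xor_ (sym (e lower o-lower)) (≡-trans (sum-δ a (λ b → p b s)) pas) ⟩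
    f lower xor true
      ≡⟨ Boolₚ.xor-comm (f lower) true ⟩
    not (f lower) ∎
  choose : ∃ λ r′ → IsOrder r′ × f r′ ≡ true × ∃ λ b → r′ b (fromℕ (suc n)) ≡ true
  -- Exactly one of the two orders gives `f` the value `true`. Both restrict to `s`, so `c` still
  -- precedes the last element.
  choose with f lower in fl
  ... | true  = lower , o-lower , fl , suc c , below
  ... | false = upper , o-upper , ≡-trans f-upper (cong not fl) , suc c , below

transpose-fst : ∀ {n} (i j : Fin n) → transpose i j i ≡ j
transpose-fst i j rewrite dec-true (i ≟ i) refl = refl

transpose-injective : ∀ {n} (i j : Fin n) {a b} → transpose i j a ≡ transpose i j b → a ≡ b
transpose-injective i j {a} {b} eq = ≡-trans (sym (transpose-inverse j i))
  (≡-trans (cong (transpose j i) eq) (transpose-inverse j i))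

-- Conjugation by the transposition of `i` and the last element reduces this to `raise-last`. The
-- indicator of `Φ` has index `suc (length Φ)`, which must not exceed the number of elements minus
-- one; hence the 2.
raise : ∀ {n} (Φ : List (Equation n)) → 2 + length Φ ≤ n → ∀ {α} → IsOrder α → All (SatEq α) Φ → ∀ i →
  ∃ λ β → IsOrder β × All (SatEq β) Φ × ∃ λ j → j ≢ i × β j i ≡ true
raise {suc n} Φ (s≤s |Φ|<n) {α} o sat i
  with raise-last n (suc (length Φ)) (low-satisfies (suc n) Φ π) |Φ|<n
         (λ a b → α (ρ a) (ρ b)) (IsOrder-∘ ρ (transpose-injective (fromℕ n) i) o)
         (satisfies⁺ (All.map (λ {e} → ≡-trans (evalForm-congʳ (proj₁ e) λ a b → cong₂ α ρπ ρπ)) sat))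
  where
  π = transpose i (fromℕ n)
  ρ = transpose (fromℕ n) i
  ρπ : ∀ {a} → ρ (π a) ≡ a
  ρπ = transpose-inverse (fromℕ n) i
... | r , o′ , sat′ , a , below =
  β , oβ , satisfies⁻ Φ sat′ , transpose (fromℕ n) i a , j≢i , ji
  where
  β : Assignment (suc n)
  β b c = r (transpose i (fromℕ n) b) (transpose i (fromℕ n) c)
  oβ : IsOrder β
  oβ = IsOrder-∘ _ (transpose-injective i (fromℕ n)) o′
  ji : β (transpose (fromℕ n) i a) i ≡ true
  ji = ≡-trans (cong₂ r (transpose-inverse i (fromℕ n)) (transpose-fst i (fromℕ n))) below
  j≢i : transpose (fromℕ n) i a ≢ i
  j≢i eq = contradiction (≡-trans (sym (irrefl oβ i)) (subst (λ j → β j i ≡ true) eq ji)) λ ()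

-- Clauses implied by a single equation

SatEq-≈ : ∀ {n} {α : Assignment n} {e e′} → e ≈E e′ → SatEq α e → SatEq α e′
SatEq-≈ {α = α} (f≈g , refl) sat = ≡-trans (sym (evalForm-congˡ f≈g α)) sat

SatC-⊆ : ∀ {n} {α : Assignment n} {C D} → C ⊆C D → SatC α C → SatC α D
SatC-⊆ C⊆D sat with find sat
... | _ , e∈C , sat-e = Any.map (λ e≈ → SatEq-≈ e≈ sat-e) (C⊆D e∈C)

SatC? : ∀ {n} (α : Assignment n) C → Dec (SatC α C)
SatC? α = Any.any? λ { (f , b) → evalForm f α Boolₚ.≟ b }

_⇛_ : ∀ {n} → Equation n → LinClause n → Set
e ⇛ C = ∀ α → SatEq α e → SatC α C

_⊕_ : ∀ {n} → Equation n → Equation n → Equation n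
(f , a) ⊕ (g , b) = (λ i j → f i j xor g i j) , a xor b

⊕-sat : ∀ {n} {α : Assignment n} (e₁ e₂ : Equation n) → SatEq α e₁ → SatEq α e₂ → SatEq α (e₁ ⊕ e₂)
⊕-sat {α = α} (f , _) (g , _) refl refl = evalForm-xorˡ f g α

-- The quantifier over assignments is not decided, so the counterexample is found only up to double
-- negation. This suffices because the eventual goal is a contradiction.
¬⇛ : ∀ {n} {e : Equation n} {C} → ¬ e ⇛ C → ¬ ¬ ∃ λ α → SatEq α e × ¬ SatC α C
¬⇛ {C = C} ¬e⇛C none = ¬e⇛C λ α sat → decidable-stable (SatC? α C) λ ¬sat → none (α , sat , ¬sat)

≢-xor : ∀ {a b c} → a ≢ c → b ≢ c → a xor b ≡ false
≢-xor {c = c} a≢c b≢c = ≡-trans (cong₂ _xor_ (Boolₚ.¬-not a≢c) (Boolₚ.¬-not b≢c)) (Boolₚ.xor-same (not c))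

_⊞_⊞_ : ∀ {n} → Assignment n → Assignment n → Assignment n → Assignment n
(u ⊞ v ⊞ w) i j = u i j xor (v i j xor w i j)

evalForm-⊞ : ∀ {n} (f : LinForm n) u v w →
  evalForm f (u ⊞ v ⊞ w) ≡ evalForm f u xor (evalForm f v xor evalForm f w)
evalForm-⊞ f u v w = ≡-trans (evalForm-xorʳ f u _) (cong (evalForm f u xor_) (evalForm-xorʳ f v w))

xor-falseʳ : ∀ {a b} → b ≡ false → a xor b ≡ a
xor-falseʳ {a} refl = xor-identityʳ a

-- The falsifying assignments of a clause form an affine space.
¬SatC-⊞ : ∀ {n} {u v w : Assignment n} {C} → ¬ SatC u C → ¬ SatC v C → ¬ SatC w C → ¬ SatC (u ⊞ v ⊞ w) C
¬SatC-⊞ {u = u} {v} {w} ¬u ¬v ¬w sat with find sat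
... | (f , b) , e∈C , sat-e = ¬u (lose e∈C (≡-trans
  (sym (≡-trans (evalForm-⊞ f u v w) (xor-falseʳ (≢-xor (¬v ∘ lose e∈C) (¬w ∘ lose e∈C))))) sat-e))

-- Assignments u₁, u₂, u₃ refuting the three alternatives would sum to one refuting the premise.
⇛-combine : ∀ {n} (e₁ e₂ : Equation n) {C} → (∀ α → SatEq α e₁ → SatEq α e₂ → SatC α C) →
  ¬ ¬ (e₁ ⇛ C ⊎ e₂ ⇛ C ⊎ (e₁ ⊕ e₂) ⇛ C)
⇛-combine e₁@(f₁ , b₁) e₂@(f₂ , b₂) {C} both none =
  ¬⇛ (none ∘ inj₁) λ { (u₁ , s₁ , ¬u₁) →
  ¬⇛ (none ∘ inj₂ ∘ inj₁) λ { (u₂ , s₂ , ¬u₂) →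
  ¬⇛ (none ∘ inj₂ ∘ inj₂) λ { (u₃ , s₃ , ¬u₃) →
  let s₃′ = ≡-trans (sym (evalForm-xorˡ f₁ f₂ u₃)) s₃ in
  ¬SatC-⊞ {u = u₁} {u₂} {u₃} ¬u₁ ¬u₂ ¬u₃ (both (u₁ ⊞ u₂ ⊞ u₃)
    -- Both `u₂` and `u₃` violate `e₁`: for `u₃`, which satisfies `e₁ ⊕ e₂`, satisfying `e₁` would
    -- force `e₂` and hence `C`. So their values of `f₁` cancel and the value at `u₁` remains. The
    -- argument for `e₂` is symmetric.
    (≡-trans (evalForm-⊞ f₁ u₁ u₂ u₃) (≡-trans
      (xor-falseʳ (≢-xor (λ s → ¬u₂ (both u₂ s s₂)) λ s → ¬u₃ (both u₃ s (xor-cancelˡ s s₃′)))) s₁))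
    (≡-trans (evalForm-⊞ f₂ u₁ u₂ u₃) (≡-trans (xor-swap (evalForm f₂ u₁) (evalForm f₂ u₂) (evalForm f₂ u₃)) (≡-trans
      (xor-falseʳ (≢-xor (λ s → ¬u₁ (both u₁ s₁ s)) λ s → ¬u₃ (both u₃ (xor-cancelʳ s s₃′) s))) s₂)))) } } }
  where
  xor-cancelˡ : ∀ {a b c d} → a ≡ c → a xor b ≡ c xor d → b ≡ d
  xor-cancelˡ {false} refl eq = eq
  xor-cancelˡ {true}  refl eq = Boolₚ.not-injective eq
  xor-cancelʳ : ∀ {a b c d} → b ≡ d → a xor b ≡ c xor d → a ≡ c
  xor-cancelʳ {a} {b} {c} {d} b≡d eq =
    xor-cancelˡ b≡d (≡-trans (Boolₚ.xor-comm b a) (≡-trans eq (Boolₚ.xor-comm c d)))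

-- Configurations along a refutation

Supported : ∀ {n} → Assignment n → LinClause n → Set
Supported α C = ∃ λ e → e ⇛ C × SatEq α e

Consistent : ∀ {n} → Config n → Set
Consistent S = ∃ λ α → IsOrder α × All (Supported α) S

supported : ∀ {n} {α : Assignment n} {C} → SatC α C → Supported α C
supported sat with find sat
... | e , e∈C , sat-e = e , (λ β → lose e∈C) , sat-e

supported-mono : ∀ {n} {α : Assignment n} {C D} → C ⊨ D → Supported α C → Supported α D
supported-mono C⊨D (e , e⇛C , sat) = e , (λ β s → C⊨D β (e⇛C β s)) , sat

-- The chosen equations and their implications do not mention `α`, so any other assignment
-- satisfying `Φ` supports the same clauses. This is what permits replacing the order.
supporting-equations : ∀ {n} {α : Assignment n} {S} → All (Supported α) S →
  ∃ λ Φ → length Φ ≡ length S × All (SatEq α) Φ × (∀ {β} → All (SatEq β) Φ → All (Supported β) S)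
supporting-equations [] = [] , refl , [] , λ _ → []
supporting-equations ((e , e⇛C , sat) ∷ sup) with supporting-equations sup
... | Φ , len , sats , back =
  e ∷ Φ , cong suc len , sat ∷ sats , λ { (s ∷ ss) → (e , e⇛C , s) ∷ back ss }

order-sat-axiom : ∀ {n} {S : Config n} {C} → OrderingClause n C → 2 + length S ≤ n → Consistent S →
  ∃ λ α → IsOrder α × SatC α C × All (Supported α) S
order-sat-axiom (antisym i j i≢j) _ (α , o , sup) = α , o , sat , sup
  where
  sat : SatC α (neg i j ∷ neg j i ∷ [])
  sat with α i j in ij
  ... | false = here (≡-trans (evalForm-var i≢j α) ij)
  ... | true  = there (here (≡-trans (evalForm-var (i≢j ∘ sym) α)
                  (≡-trans (compare o (i≢j ∘ sym)) (cong not ij))))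
order-sat-axiom (total i j i≢j) _ (α , o , sup) = α , o , sat , sup
  where
  sat : SatC α (pos i j ∷ pos j i ∷ [])
  sat with α i j in ij
  ... | true  = here (≡-trans (evalForm-var i≢j α) ij)
  ... | false = there (here (≡-trans (evalForm-var (i≢j ∘ sym) α)
                  (≡-trans (compare o (i≢j ∘ sym)) (cong not ij))))
order-sat-axiom (trans i j k i≢j j≢k i≢k) _ (α , o , sup) = α , o , sat , sup
  where
  sat : SatC α (neg i j ∷ neg j k ∷ pos i k ∷ [])
  sat with α i j in ij | α j k in jk
  ... | false | _     = here (≡-trans (evalForm-var i≢j α) ij)
  ... | true  | false = there (here (≡-trans (evalForm-var j≢k α) jk))
  ... | true  | true  = there (there (here (≡-trans (evalForm-var i≢k α) (transit o ij jk))))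
-- There is one equation per clause, so the bound on `length S` is the one `raise` asks for. In the
-- new order `β` some `j` precedes `i`, which satisfies the literal `pos j i`.
order-sat-axiom {n} (nonmin i) |S|+2≤n (α , o , sup) with supporting-equations sup
... | Φ , len , sats , back with raise Φ (subst (λ k → 2 + k ≤ n) (sym len) |S|+2≤n) o sats i
...   | β , oβ , satsβ , j , j≢i , ji = β , oβ ,
  lose (∈-map⁺ (λ j → pos j i) (∈-filter⁺ (λ j → ¬? (j ≟ i)) (∈-allFin j) j≢i))
       (≡-trans (evalForm-var j≢i β) ji) ,
  back satsβ

resolve-sound : ∀ {n} {α : Assignment n} {C₁ C₂ A B D f g} → f ≈F g →
  C₁ ⊆C ((f , false) ∷ A) → C₂ ⊆C ((g , true) ∷ B) → (A ++ B) ⊆C D →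
  SatC α C₁ → SatC α C₂ → SatC α D
resolve-sound {α = α} {A = A} f≈g C₁⊆ C₂⊆ ⊆D s₁ s₂ with SatC-⊆ C₁⊆ s₁ | SatC-⊆ C₂⊆ s₂
... | there sA | _        = SatC-⊆ ⊆D (Anyₚ.++⁺ˡ sA)
... | here _   | there sB = SatC-⊆ ⊆D (Anyₚ.++⁺ʳ A sB)
... | here f0  | here g1  =
  contradiction (≡-trans (sym f0) (≡-trans (evalForm-congˡ f≈g α) g1)) λ ()

-- The double negation comes from `⇛-combine` in the resolution case. The bound is imposed on `S`,
-- before the step, since the order is replaced before the new axiom joins the configuration.
step-consistent : ∀ {n} {S S′ : Config n} → Step n S S′ → 2 + length S ≤ n → Consistent S → ¬ ¬ Consistent S′
step-consistent (axiom C D ax (_ , C⊆D)) |S|+2≤n con none with order-sat-axiom ax |S|+2≤n con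
... | α , o , sat , sup = none (α , o , supported (SatC-⊆ C⊆D sat) ∷ sup)
step-consistent (erase xs ys C refl) _ (α , o , sup) none with Allₚ.++⁻ xs sup
... | supˡ , _ ∷ supʳ = none (α , o , Allₚ.++⁺ supˡ supʳ)
step-consistent (resolve C₁ C₂ A B D f g C₁∈S C₂∈S f≈g (C₁⊆ , _) (C₂⊆ , _) (_ , ⊆D)) _ (α , o , sup) none
  with All.lookup sup C₁∈S | All.lookup sup C₂∈S
... | e₁ , e₁⇛ , s₁ | e₂ , e₂⇛ , s₂ =
  ⇛-combine e₁ e₂ (λ β t₁ t₂ → resolve-sound f≈g C₁⊆ C₂⊆ ⊆D (e₁⇛ β t₁) (e₂⇛ β t₂)) λ where
    (inj₁ e₁⇛D)        → none (α , o , (e₁ , e₁⇛D , s₁) ∷ sup)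
    (inj₂ (inj₁ e₂⇛D)) → none (α , o , (e₂ , e₂⇛D , s₂) ∷ sup)
    (inj₂ (inj₂ e⇛D))  → none (α , o , (e₁ ⊕ e₂ , e⇛D , ⊕-sat e₁ e₂ s₁ s₂) ∷ sup)
step-consistent (weaken C D C∈S C⊨D) _ (α , o , sup) none =
  none (α , o , supported-mono C⊨D (All.lookup sup C∈S) ∷ sup)

-- The space lower bound

-- Consistency passes along the derivation up to `done`, where the equation supporting `[]` is true
-- at `α` and would make the empty clause true.
small-space-inconsistent : ∀ {n S} (d : Derivation n S) → 2 + space d ≤ n → ¬ Consistent S
small-space-inconsistent (done []∈S) _ (α , _ , sup) with All.lookup sup []∈S
... | e , e⇛[] , sat with () ← e⇛[] α sat
small-space-inconsistent {S = S} (step s d) small con =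
  step-consistent s (ℕₚ.≤-trans (s≤s (s≤s (ℕₚ.m≤m⊔n (length S) (space d)))) small) con
    (small-space-inconsistent d (ℕₚ.≤-trans (s≤s (s≤s (ℕₚ.m≤n⊔m (length S) (space d)))) small))

space-positive : ∀ {n S} (d : Derivation n S) → 1 ≤ space d
space-positive (done (here _))  = s≤s z≤n
space-positive (done (there _)) = s≤s z≤n
space-positive {S = S} (step _ d) = ℕₚ.≤-trans (space-positive d) (ℕₚ.m≤n⊔m (length S) (space d))

theorem4p12 : ∃₂ λ (c n₀ : ℕ) → (n : ℕ) → n₀ ≤ n → (π : Refutation n) → n ≤ c * space π
theorem4p12 = 2 , 0 , bound
  where
  bound : ∀ n → 0 ≤ n → (π : Refutation n) → n ≤ 2 * space π
  bound n _ π = ℕₚ.≮⇒≥ λ 2s<n → small-space-inconsistent π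
    -- Space at least one gives `2 + space π ≤ 1 + 2 * space π`, so the factor 2 absorbs the
    -- additive constant and no threshold on `n` is required.
    (ℕₚ.≤-trans (s≤s (ℕₚ.≤-trans (ℕₚ.+-monoˡ-≤ (space π) (space-positive π))
      (ℕₚ.+-monoʳ-≤ (space π) (ℕₚ.m≤m+n (space π) 0)))) 2s<n)
    -- The empty configuration is consistent with any order.
    (let r , o = order-exists n in r , o , [])
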